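{- Let $\mathbf W=(W,\le,P)$ be a preorder forest $P$-frame and let $\mathbf D(\mathbf W)$ be its downset algebra. Then the operation $x\cdot y=(\mathsf p x\wedge y)\vee(x\wedge\mathsf p y)$ is associative in $\mathbf D(\mathbf W)$.
   Context: A $P$-frame is a structure $(W,\le,P)$ where $(W,\le)$ is a poset and $P\subseteq W^2$ is a weakening relation: $u\le x$, $xPy$, $y\le v$ imply $uPv$. A preorder forest $P$-frame is a $P$-frame in which $P$ is a preorder (reflexive and transitive) and which satisfies, for all $x,y,z\in W$: (Pforest) $xPy$ and $xPz$ imply ($x\le y$ or $x\le z$ or $yPz$ or $zPy$). The downset algebra $\mathbf D(\mathbf W)$ is the lattice of all downsets of $(W,\le)$ (subsets $X$ with $y\le x\in X\Rightarrow y\in X$), with $\wedge=\cap$, $\vee=\cup$, together with the unary operation $\mathsf p(Y)=\{x\in W\mid\exists y(xPy\text{ and }y\in Y)\}$. -}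

module Defs where

open import Data.Product using (_,_; ∃; _×_)
open import Data.Sum using (_⊎_)
import Data.Sum as Sum
import Data.Product as Product
open import Level using (Level; _⊔_; suc)
open import Relation.Binary.Bundles using (Poset)
open import Relation.Binary.Core using (Rel)
open import Relation.Binary.Structures using (IsPreorder)
open import Relation.Unary using (Pred; _∈_; _∩_; _∪_; _≐_)

record PFrame (c ℓ₁ ℓ₂ p : Level) : Set (suc (c ⊔ ℓ₁ ⊔ ℓ₂ ⊔ p)) where
  infix 4 _P_
  field
    poset : Poset c ℓ₁ ℓ₂

  open Poset poset public using (Carrier; _≈_; _≤_)

  field
    _P_       : Rel Carrier p
    weakening : ∀ {u x y v} → u ≤ x → x P y → y ≤ v → u P v

record IsPreorderForest {c ℓ₁ ℓ₂ p} (W : PFrame c ℓ₁ ℓ₂ p)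
                        : Set (c ⊔ ℓ₁ ⊔ ℓ₂ ⊔ p) where
  open PFrame W
  field
    -- IsPreorder states reflexivity as _≈_ ⇒ _P_; by weakening this is the
    -- same as ∀ {x} → x P x.
    isPreorder : IsPreorder _≈_ _P_
    pforest    : ∀ {x y z} → x P y → x P z →
                 x ≤ y ⊎ x ≤ z ⊎ y P z ⊎ z P y

-- Since 𝗉 quantifies over the carrier, the universe level of downsets has to
-- lie above c and p for 𝗉 to be an operation on them; ℓ is otherwise free.
module DownsetAlgebra {c ℓ₁ ℓ₂ p} (W : PFrame c ℓ₁ ℓ₂ p) (ℓ : Level) where
  open PFrame W

  private
    d : Level
    d = c ⊔ p ⊔ ℓ

  record Downset : Set (ℓ₂ ⊔ suc d) where
    field
      set    : Pred Carrier d
      closed : ∀ {x y} → y ≤ x → x ∈ set → y ∈ set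

  open Downset

  infix  4 _≈ᴰ_
  infixr 7 _∧_
  infixr 6 _∨_
  infixl 8 _·_

  _≈ᴰ_ : Rel Downset (c ⊔ d)
  X ≈ᴰ Y = set X ≐ set Y

  _∧_ : Downset → Downset → Downset
  X ∧ Y = record
    { set    = set X ∩ set Y
    ; closed = λ y≤x → Product.map (closed X y≤x) (closed Y y≤x)
    }

  _∨_ : Downset → Downset → Downset
  X ∨ Y = record
    { set    = set X ∪ set Y
    ; closed = λ y≤x → Sum.map (closed X y≤x) (closed Y y≤x)
    }

  𝗉 : Downset → Downset
  𝗉 Y = record
    { set    = λ x → ∃ λ y → x P y × y ∈ set Y
    ; closed = λ { x′≤x (y , xPy , y∈Y) →
                   y , weakening x′≤x xPy (Poset.refl poset) , y∈Y }
    }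

  _·_ : Downset → Downset → Downset
  X · Y = (𝗉 X ∧ Y) ∨ (X ∧ 𝗉 Y)

{-# OPTIONS --safe #-}
-- The forest condition yields the identity 𝗉 (X · Y) = 𝗉 X ∧ 𝗉 Y. Given
-- it, both bracketings of a triple product distribute to
-- (𝗉 X ∧ 𝗉 Y ∧ Z) ∨ (𝗉 X ∧ Y ∧ 𝗉 Z) ∨ (X ∧ 𝗉 Y ∧ 𝗉 Z).
module Submission where

open import Defs
open import Algebra.Definitions using (Associative)
open import Data.Product using (_,_)
open import Data.Sum using (inj₁; inj₂)
open import Level using (Level)
open import Relation.Binary.Structures using (IsPreorder)
open import Relation.Unary using (_⊆_)

-- In the identity, transitivity of `P` gives the inclusion from left to right (`𝗉-·⊆∧`). The
-- converse (`𝗉-∧⊆·`) must merge two `P`-successors of a point, one in `X` and one in `Y`, into a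
-- single witness in `X · Y`; this is where `pforest` enters.

module _ {c ℓ₁ ℓ₂ p} (W : PFrame c ℓ₁ ℓ₂ p) (forest : IsPreorderForest W)
         (ℓ : Level) where
  open PFrame W using (_P_)
  open IsPreorderForest forest
  open IsPreorder isPreorder using () renaming (refl to P-refl; trans to P-trans)
  open DownsetAlgebra W ℓ
  open Downset

  ⊆𝗉 : ∀ X → set X ⊆ set (𝗉 X)
  ⊆𝗉 X {x} x∈X = x , P-refl , x∈X

  𝗉-·⊆∧ : ∀ X Y → set (𝗉 (X · Y)) ⊆ set (𝗉 X ∧ 𝗉 Y)
  𝗉-·⊆∧ X Y (y , xPy , inj₁ ((a , yPa , a∈X) , y∈Y)) =
    (a , P-trans xPy yPa , a∈X) , (y , xPy , y∈Y)
  𝗉-·⊆∧ X Y (y , xPy , inj₂ (y∈X , (b , yPb , b∈Y))) =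
    (y , xPy , y∈X) , (b , P-trans xPy yPb , b∈Y)

  -- The witness is one of `x`, `a`, `b`. If `x` is below `a` or `b`, downset closure puts `x`
  -- itself in `X · Y`; otherwise one of `a`, `b` is `P`-related to the other, and that one works.
  𝗉-∧⊆· : ∀ X Y → set (𝗉 X ∧ 𝗉 Y) ⊆ set (𝗉 (X · Y))
  𝗉-∧⊆· X Y {x} (x∈𝗉X@(a , xPa , a∈X) , x∈𝗉Y@(b , xPb , b∈Y))
    with pforest xPa xPb
  ... | inj₁ x≤a               = ⊆𝗉 (X · Y) (inj₂ (closed X x≤a a∈X , x∈𝗉Y))
  ... | inj₂ (inj₁ x≤b)        = ⊆𝗉 (X · Y) (inj₁ (x∈𝗉X , closed Y x≤b b∈Y))
  ... | inj₂ (inj₂ (inj₁ aPb)) = a , xPa , inj₂ (a∈X , (b , aPb , b∈Y))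
  ... | inj₂ (inj₂ (inj₂ bPa)) = b , xPb , inj₁ ((a , bPa , a∈X) , b∈Y)

  ·-assoc : Associative _≈ᴰ_ _·_
  ·-assoc X Y Z = to , from
    where
    to : set ((X · Y) · Z) ⊆ set (X · (Y · Z))
    to (inj₁ (x∈𝗉XY , x∈Z)) with 𝗉-·⊆∧ X Y x∈𝗉XY
    ... | x∈𝗉X , x∈𝗉Y = inj₁ (x∈𝗉X , inj₁ (x∈𝗉Y , x∈Z))
    -- The middle term is common to both bracketings and is only regrouped; the outer two need the
    -- identity, one inclusion each.
    to (inj₂ (inj₁ (x∈𝗉X , x∈Y) , x∈𝗉Z)) = inj₁ (x∈𝗉X , inj₂ (x∈Y , x∈𝗉Z))
    to (inj₂ (inj₂ (x∈X , x∈𝗉Y) , x∈𝗉Z)) = inj₂ (x∈X , 𝗉-∧⊆· Y Z (x∈𝗉Y , x∈𝗉Z))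

    from : set (X · (Y · Z)) ⊆ set ((X · Y) · Z)
    from (inj₁ (x∈𝗉X , inj₁ (x∈𝗉Y , x∈Z))) = inj₁ (𝗉-∧⊆· X Y (x∈𝗉X , x∈𝗉Y) , x∈Z)
    from (inj₁ (x∈𝗉X , inj₂ (x∈Y , x∈𝗉Z))) = inj₂ (inj₁ (x∈𝗉X , x∈Y) , x∈𝗉Z)
    from (inj₂ (x∈X , x∈𝗉YZ)) with 𝗉-·⊆∧ Y Z x∈𝗉YZ
    ... | x∈𝗉Y , x∈𝗉Z = inj₂ (inj₂ (x∈X , x∈𝗉Y) , x∈𝗉Z)

theorem4p9 : ∀ {c ℓ₁ ℓ₂ p} (W : PFrame c ℓ₁ ℓ₂ p) → IsPreorderForest W →
    ∀ ℓ → let open DownsetAlgebra W ℓ in Associative _≈ᴰ_ _·_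
theorem4p9 = ·-assoc
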